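{- There is a constant $\kappa > 0$ such that for all integers $n \geq 1$ and $d \geq 2$, every formula computing $\mathrm{OV}_{n,d}$ whose gates compute arbitrary symmetric Boolean functions of unbounded fan-in has at least $$\kappa\cdot\min\left\{\frac{n^2}{\log d},\ \frac{n\cdot 2^d}{d^{1/2}\log d}\right\}$$ wires.
   Context: The Orthogonal Vectors function $\mathrm{OV}_{n,d}:\{0,1\}^{nd}\to\{0,1\}$ takes $n$ vectors $v_1,\ldots,v_n \in \{0,1\}^d$ and outputs $1$ iff there exist $i,j$ with $\langle v_i,v_j\rangle = 0$. A symmetric-gate formula is a rooted tree whose leaves are labeled by input variables and whose internal nodes are gates of arbitrary (unbounded) fan-in, each computing some symmetric Boolean function of its inputs (a function depending only on the number of ones among its inputs). The number of wires is the number of edges of the tree. -}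

module Defs where

open import Data.Nat using (ℕ; zero; suc; _+_)
open import Data.Bool using (Bool; true; false; _∧_; _∨_; if_then_else_)
open import Data.Fin using (Fin; zero; suc)
open import Data.List using (List; []; _∷_; length)
open import Data.Product using (_×_)
open import Relation.Binary.PropositionalEquality using (_≡_)

-- Symmetric-gate formulas over a set V of input variables.
-- A gate of fan-in k computing a symmetric Boolean function is given by
-- its value as a function of the number of ones among its inputs
-- (g : ℕ → Bool; only the values at 0..k matter).
data Formula (V : Set) : Set where
  leaf : V → Formula V
  gate : (ℕ → Bool) → List (Formula V) → Formula V

mutual
  eval : {V : Set} → (V → Bool) → Formula V → Bool
  eval ρ (leaf v)    = ρ v
  eval ρ (gate g fs) = g (countOnes ρ fs)

  countOnes : {V : Set} → (V → Bool) → List (Formula V) → ℕ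
  countOnes ρ []       = 0
  countOnes ρ (f ∷ fs) = (if eval ρ f then 1 else 0) + countOnes ρ fs

mutual
  wires : {V : Set} → Formula V → ℕ
  wires (leaf v)    = 0
  wires (gate g fs) = length fs + wiresList fs

  wiresList : {V : Set} → List (Formula V) → ℕ
  wiresList []       = 0
  wiresList (f ∷ fs) = wires f + wiresList fs

Computes : {V : Set} → Formula V → ((V → Bool) → Bool) → Set
Computes F f = ∀ ρ → eval ρ F ≡ f ρ

sumFin : (d : ℕ) → (Fin d → ℕ) → ℕ
sumFin zero    f = 0
sumFin (suc d) f = f zero + sumFin d (λ k → f (suc k))

anyFin : (n : ℕ) → (Fin n → Bool) → Bool
anyFin zero    p = false
anyFin (suc n) p = p zero ∨ anyFin n (λ i → p (suc i))

inner : {d : ℕ} → (Fin d → Bool) → (Fin d → Bool) → ℕ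
inner {d} u v = sumFin d (λ k → if u k ∧ v k then 1 else 0)

isZero : ℕ → Bool
isZero zero    = true
isZero (suc _) = false

OV : (n d : ℕ) → (Fin n × Fin d → Bool) → Bool
OV n d x = anyFin n (λ i → anyFin n (λ j →
             isZero (inner (λ k → x (i Data.Product., k)) (λ k → x (j Data.Product., k)))))

{-# OPTIONS --safe #-}

-- Nechiporuk's method, with one block of variables per vector.  Fix a block containing L leaves.
-- Replacing the leaves outside it by constants shifts the count at each gate by a constant, so a
-- gate with k ≥ 2 children meeting the block is described by k + 1 bits, and a gate with a single
-- such child acts as a unary Boolean function.  Hence at most 2 ^ (7 L) subfunctions arise.
-- In OV, take m = min (n - 1, C (d - 1, ⌊(d - 1) / 2⌋)) distinct words of middle weight: each
-- subset of them, written into the other rows, is recovered by querying the fixed row with the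
-- complements of the words.  So m ≤ 7 L, and summing over the n blocks gives n m ≤ 7 (wires);
-- the middle binomial coefficient is at least of order 2 ^ d / √ d.
module Submission where

open import Defs
open import Data.Nat using (ℕ; _+_; _*_; _^_; _≤_; _⊓_)
open import Data.Nat.Logarithm using (⌊log₂_⌋)
open import Data.Fin using (Fin)
open import Data.Product using (Σ; _×_)

open import Data.Bool using (Bool; true; false; not; _∧_; if_then_else_)
open import Data.Bool.Properties using (∨-zeroʳ; not-¬)
open import Data.Empty using (⊥)
open import Data.Fin using (zero; suc; toℕ; fromℕ<; combine; finToFun; funToFin; inject≤; punchIn)
open import Data.Fin.Properties
  using (_≟_; any?; toℕ-fromℕ<; combine-injective; funToFin-finToFin; injective⇒≤;
         inject≤-injective; punchIn-injective; punchInᵢ≢i; 2↔Bool)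
open import Data.Fin.Subset using (Subset; ∣_∣; ∁)
open import Data.Fin.Subset.Properties using (∣∁p∣≡n∸∣p∣)
open import Data.List using (List; []; _∷_; length)
import Data.List as List
open import Data.List.Properties using (length-map; length-++)
open import Data.List.Membership.Propositional.Properties using (∈-map⁻; ∈-lookup)
open import Data.List.Relation.Unary.All as All using (All; []; _∷_)
import Data.List.Relation.Unary.All.Properties as All
open import Data.List.Relation.Unary.AllPairs using ([]; _∷_)
open import Data.List.Relation.Unary.Unique.Propositional using (Unique)
import Data.List.Relation.Unary.Unique.Propositional.Properties as Unique
open import Data.Nat using (zero; suc; _∸_; _<_; z≤n; s≤s; _!; ⌊_/2⌋)
open import Data.Nat.Properties hiding (_≟_)
open import Data.Nat.Combinatorics using (_C_; nCk≡n!/k![n-k]!; k![n∸k]!∣n!; nCk+nC[k+1]≡[n+1]C[k+1])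
open import Data.Nat.DivMod using (m/n*n≡m)
open import Data.Nat.Logarithm using (⌊log₂⌋-mono-≤)
open import Data.Nat.Tactic.RingSolver using (solve-∀)
open import Data.Product using (∃; _,_)
open import Data.Sum using (_⊎_; inj₁; inj₂)
open import Data.Vec using (Vec; []; _∷_; _++_; tabulate; lookup)
open import Data.Vec.Properties using (++-injective; ∷-injective; ∷-injectiveʳ; lookup∘tabulate; lookup-map)
open import Function using (_∘_; Inverse)
open import Relation.Binary.PropositionalEquality
open import Relation.Nullary using (Dec; yes; no; does; contradiction)
open import Relation.Nullary.Decidable using (dec-true; dec-false)

private variable
  V A A₁ A₂ : Set
  m n d k N N₁ N₂ : ℕ

-- Blocks of variables and bit codes for subfunctions.

bit : Bool → ℕ
bit b = if b then 1 else 0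

mutual
  leavesIn : (V → Bool) → Formula V → ℕ
  leavesIn B (leaf v)    = bit (B v)
  leavesIn B (gate g fs) = leavesInList B fs

  leavesInList : (V → Bool) → List (Formula V) → ℕ
  leavesInList B []       = 0
  leavesInList B (f ∷ fs) = leavesIn B f + leavesInList B fs

override : (V → Bool) → (V → Bool) → (V → Bool) → V → Bool
override B σ τ v = if B v then τ v else σ v

-- An upper bound on subfunctions: `f σ`, as a function of the block assignment `τ`, depends on the
-- outside assignment `σ` only through `N` bits, so at most `2 ^ N` such functions arise.
record Code {V A : Set} (f : (V → Bool) → (V → Bool) → A) (N : ℕ) : Set where
  constructor code
  field
    encode : (V → Bool) → Vec Bool N
    sound  : ∀ σ σ′ → encode σ ≡ encode σ′ → ∀ τ → f σ τ ≡ f σ′ τ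

-- The two extra bits are the truth table of `u σ`.
unaryCode : {c : (V → Bool) → (V → Bool) → Bool} (u : (V → Bool) → Bool → Bool) →
            Code c N → Code (λ σ τ → u σ (c σ τ)) (2 + N)
unaryCode {c = c} u (code enc snd) = code (λ σ → u σ false ∷ u σ true ∷ enc σ) sound
  where
  sound : ∀ σ σ′ → _ → ∀ τ → u σ (c σ τ) ≡ u σ′ (c σ′ τ)
  sound σ σ′ eq τ with ∷-injective eq
  ... | eq₀ , eq₁₂ with ∷-injective eq₁₂
  ...   | eq₁ , eq₂ with c σ τ | c σ′ τ | snd σ σ′ eq₂ τ
  ...     | false | _ | refl = eq₀
  ...     | true  | _ | refl = eq₁

pairCode : {f : (V → Bool) → (V → Bool) → A₁} {g : (V → Bool) → (V → Bool) → A₂}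
           (h : A₁ → A₂ → A) → Code f N₁ → Code g N₂ →
           Code (λ σ τ → h (f σ τ) (g σ τ)) (N₁ + N₂)
pairCode h (code enc₁ snd₁) (code enc₂ snd₂) = code (λ σ → enc₁ σ ++ enc₂ σ) λ σ σ′ eq τ →
  let eq₁ , eq₂ = ++-injective (enc₁ σ) (enc₁ σ′) eq
  in cong₂ h (snd₁ σ σ′ eq₁ τ) (snd₂ σ σ′ eq₂ τ)

tabulate-injective : {f g : Fin n → A} → tabulate f ≡ tabulate g → f ≗ g
tabulate-injective {f = f} {g} eq i =
  trans (sym (lookup∘tabulate f i)) (trans (cong (λ v → lookup v i) eq) (lookup∘tabulate g i))

-- The offset `s σ` may be large, but only the values of `g` on the window from `s σ` to `s σ + k`
-- matter; these are the `k + 1` new bits.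
gateCode : {t : (V → Bool) → (V → Bool) → ℕ} (g : ℕ → Bool) (s : (V → Bool) → ℕ) →
           (∀ σ τ → t σ τ ≤ k) → Code t N →
           Code (λ σ τ → g (s σ + t σ τ)) (N + suc k)
gateCode {k = k} {t = t} g s t≤k (code enc snd) =
  code (λ σ → enc σ ++ tabulate (table σ)) sound
  where
  table : _ → Fin (suc k) → Bool
  table σ i = g (s σ + toℕ i)
  table-lookup : ∀ σ {x} (x≤k : x < suc k) → table σ (fromℕ< x≤k) ≡ g (s σ + x)
  table-lookup σ x≤k = cong (λ x → g (s σ + x)) (toℕ-fromℕ< x≤k)
  sound : ∀ σ σ′ → _ → ∀ τ → g (s σ + t σ τ) ≡ g (s σ′ + t σ′ τ)
  sound σ σ′ eq τ with ++-injective (enc σ) (enc σ′) eq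
  ... | eq₁ , eq₂ rewrite snd σ σ′ eq₁ τ =
    trans (sym (table-lookup σ (s≤s (t≤k σ′ τ))))
      (trans (tabulate-injective {f = table σ} {table σ′} eq₂ _) (table-lookup σ′ (s≤s (t≤k σ′ τ))))

-- Reduction of a formula to one block.

-- A subformula meeting the block is a core of τ followed by a unary function that depends on σ
-- only.  Chains of gates with a single child meeting the block change the unary function but
-- not the core, so they cost no bits.
data Reduced (B : V → Bool) (F : Formula V) : Set where
  constant : (s : (V → Bool) → Bool) → (∀ σ τ → eval (override B σ τ) F ≡ s σ) → Reduced B F
  unary    : (u : (V → Bool) → Bool → Bool) {c : (V → Bool) → (V → Bool) → Bool} →
             Code c N → 7 + N ≤ 7 * leavesIn B F →
             (∀ σ τ → eval (override B σ τ) F ≡ u σ (c σ τ)) → Reduced B F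

-- The cases are no child, one child, or at least two children reducing to `unary`. Each such child
-- holds 7 bits in reserve. In `many`, 2 of them record its unary function and 5 are saved, whence
-- `5 * k`. The savings pay for the table of the gate and restore a reserve of 7.
data ReducedList (B : V → Bool) (fs : List (Formula V)) : Set where
  constant : (s : (V → Bool) → ℕ) → (∀ σ τ → countOnes (override B σ τ) fs ≡ s σ) →
             ReducedList B fs
  unary    : (s : (V → Bool) → ℕ) (u : (V → Bool) → Bool → Bool)
             {c : (V → Bool) → (V → Bool) → Bool} →
             Code c N → 7 + N ≤ 7 * leavesInList B fs →
             (∀ σ τ → countOnes (override B σ τ) fs ≡ s σ + bit (u σ (c σ τ))) →
             ReducedList B fs
  many     : (s : (V → Bool) → ℕ) {t : (V → Bool) → (V → Bool) → ℕ} →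
             Code t N → 2 ≤ k → (∀ σ τ → t σ τ ≤ k) → 5 * k + N ≤ 7 * leavesInList B fs →
             (∀ σ τ → countOnes (override B σ τ) fs ≡ s σ + t σ τ) →
             ReducedList B fs

bit≤1 : ∀ b → bit b ≤ 1
bit≤1 false = z≤n
bit≤1 true  = ≤-refl

private
  add-bounds : ∀ a b x y {z} → x ≤ 7 * a → y ≤ 7 * b → z ≡ x + y → z ≤ 7 * (a + b)
  add-bounds a b x y x≤a y≤b refl = ≤-trans (+-mono-≤ x≤a y≤b) (≤-reflexive (sym (*-distribˡ-+ 7 a b)))

mutual
  reduce : (B : V → Bool) (F : Formula V) → Reduced B F
  reduce B (leaf v) with B v in eq
  ... | false = constant (λ σ → σ v) λ σ τ → cong (λ b → if b then τ v else σ v) eq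
  -- The core is the variable itself and needs no bits, so one leaf pays exactly the reserve
  -- `7 + 0`.
  ... | true  = unary (λ _ b → b) {c = λ _ τ → τ v} (code (λ _ → []) λ _ _ _ _ → refl)
                  (≤-reflexive (cong (λ b → 7 * bit b) (sym eq)))
                  λ σ τ → cong (λ b → if b then τ v else σ v) eq
  reduce B (gate g fs) with reduceList B fs
  ... | constant s eq = constant (g ∘ s) λ σ τ → cong g (eq σ τ)
  ... | unary s u c bound eq =
    unary (λ σ b → g (s σ + bit (u σ b))) c bound λ σ τ → cong g (eq σ τ)
  ... | many {N = N} {k = k} s {t} c 2≤k t≤k bound eq =
    -- The output of the gate becomes the new core, and the unary function starts again as the
    -- identity.
    unary (λ _ b → b) (gateCode g s t≤k c) (≤-trans core-bound bound) λ σ τ → cong g (eq σ τ)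
    where
    open ≤-Reasoning
    core-bound : 7 + (N + suc k) ≤ 5 * k + N
    core-bound = begin
      7 + (N + suc k)     ≡⟨ regroup₁ N k ⟩
      -- Two varying children suffice here: `8 ≤ 4 * k` covers the reserve of 7 and the one table
      -- bit beyond `k`.
      4 * 2 + (k + N)     ≤⟨ +-monoˡ-≤ (k + N) (*-monoʳ-≤ 4 2≤k) ⟩
      4 * k + (k + N)     ≡⟨ regroup₂ N k ⟩
      5 * k + N           ∎
      where
      regroup₁ : ∀ N k → 7 + (N + (1 + k)) ≡ 8 + (k + N)
      regroup₁ = solve-∀
      regroup₂ : ∀ N k → 4 * k + (k + N) ≡ 5 * k + N
      regroup₂ = solve-∀

  reduceList : (B : V → Bool) (fs : List (Formula V)) → ReducedList B fs
  reduceList B [] = constant (λ _ → 0) λ _ _ → refl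
  reduceList B (f ∷ fs) with reduce B f | reduceList B fs
  ... | constant s eq | constant s′ eq′ =
    constant (λ σ → bit (s σ) + s′ σ) λ σ τ → cong₂ (λ b x → bit b + x) (eq σ τ) (eq′ σ τ)
  ... | constant s eq | unary s′ u c bound eq′ =
    unary (λ σ → bit (s σ) + s′ σ) u c (≤-trans bound (*-monoʳ-≤ 7 (m≤n+m _ (leavesIn B f))))
      λ σ τ → trans (cong₂ (λ b x → bit b + x) (eq σ τ) (eq′ σ τ)) (sym (+-assoc (bit (s σ)) _ _))
  ... | constant s eq | many s′ c 2≤k t≤k bound eq′ =
    many (λ σ → bit (s σ) + s′ σ) c 2≤k t≤k (≤-trans bound (*-monoʳ-≤ 7 (m≤n+m _ (leavesIn B f))))
      λ σ τ → trans (cong₂ (λ b x → bit b + x) (eq σ τ) (eq′ σ τ)) (sym (+-assoc (bit (s σ)) _ _))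
  ... | unary u {c = c₀} c bound eq | constant s′ eq′ =
    unary s′ u c (≤-trans bound (*-monoʳ-≤ 7 (m≤m+n (leavesIn B f) _)))
      λ σ τ → trans (cong₂ (λ b x → bit b + x) (eq σ τ) (eq′ σ τ)) (+-comm (bit (u σ (c₀ σ τ))) _)
  ... | unary {N = N₁} u {c₁} c bound eq | unary {N = N₂} s′ u′ {c₂} c′ bound′ eq′ =
    many s′ (pairCode (λ b b′ → bit b + bit b′) (unaryCode u c) (unaryCode u′ c′)) ≤-refl
      (λ σ τ → +-mono-≤ (bit≤1 (u σ (c₁ σ τ))) (bit≤1 (u′ σ (c₂ σ τ))))
      (add-bounds (leavesIn B f) _ _ _ bound bound′ (regroup N₁ N₂))
      λ σ τ → trans (cong₂ (λ b x → bit b + x) (eq σ τ) (eq′ σ τ))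
                (swap (bit (u σ (c₁ σ τ))) (s′ σ) (bit (u′ σ (c₂ σ τ))))
    where
    regroup : ∀ x y → 10 + (2 + x + (2 + y)) ≡ 7 + x + (7 + y)
    regroup = solve-∀
    swap : ∀ x y z → x + (y + z) ≡ y + (x + z)
    swap = solve-∀
  ... | unary {N = N₁} u {c₁} c bound eq | many {N = N₂} {k = k} s′ {t} c′ 2≤k t≤k bound′ eq′ =
    many s′ (pairCode (λ b x → bit b + x) (unaryCode u c) c′) (m≤n⇒m≤1+n 2≤k)
      (λ σ τ → +-mono-≤ (bit≤1 (u σ (c₁ σ τ))) (t≤k σ τ))
      (add-bounds (leavesIn B f) _ _ _ bound bound′ (regroup N₁ N₂ k))
      λ σ τ → trans (cong₂ (λ b x → bit b + x) (eq σ τ) (eq′ σ τ))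
                (swap (bit (u σ (c₁ σ τ))) (s′ σ) (t σ τ))
    where
    regroup : ∀ x y k → 5 * (1 + k) + (2 + x + y) ≡ 7 + x + (5 * k + y)
    regroup = solve-∀
    swap : ∀ x y z → x + (y + z) ≡ y + (x + z)
    swap = solve-∀

-- Counting subfunctions by shattering.

bitsToFin : Vec Bool n → Fin (2 ^ n)
bitsToFin []       = zero
bitsToFin (b ∷ bs) = combine (Inverse.from 2↔Bool b) (bitsToFin bs)

bitsToFin-injective : (u v : Vec Bool n) → bitsToFin u ≡ bitsToFin v → u ≡ v
bitsToFin-injective []       []       _  = refl
bitsToFin-injective (b ∷ u) (c ∷ v) eq
  with combine-injective (Inverse.from 2↔Bool b) (bitsToFin u) (Inverse.from 2↔Bool c) (bitsToFin v) eq
... | eq₁ , eq₂ = cong₂ _∷_ (from-injective b c eq₁) (bitsToFin-injective u v eq₂)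
  where
  from-injective : ∀ b c → Inverse.from 2↔Bool b ≡ Inverse.from 2↔Bool c → b ≡ c
  from-injective b c eq = trans (sym (Inverse.strictlyInverseˡ 2↔Bool b))
    (trans (cong (Inverse.to 2↔Bool) eq) (Inverse.strictlyInverseˡ 2↔Bool c))

-- The queries `τ q` recover `S` from the subfunction at `σ S`, so all `2 ^ m` sets give different
-- codes. The query `τ₀` excludes the constant case: with `S` all true it answers false, while every
-- `τ q` answers true.
shattered≤7*leaves : (B : V → Bool) (F : Formula V)
  (σ : (Fin m → Bool) → V → Bool) (τ₀ : V → Bool) (τ : Fin m → V → Bool) →
  (∀ S → eval (override B (σ S) τ₀) F ≡ false) →
  (∀ S q → eval (override B (σ S) (τ q)) F ≡ S q) →
  m ≤ 7 * leavesIn B F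
shattered≤7*leaves {m = zero}  B F σ τ₀ τ null dec = z≤n
shattered≤7*leaves {m = suc m} B F σ τ₀ τ null dec with reduce B F
... | constant s eq =
  contradiction (trans (sym (null S)) (trans (eq _ _) (trans (sym (eq _ _)) (dec S zero)))) λ ()
  where S = λ _ → true
... | unary {N = N} u c bound eq = begin
  suc m              ≤⟨ ^-cancelʳ-≤ (injective⇒≤ index-injective) ⟩
  2 + N              ≤⟨ +-monoˡ-≤ N (m≤m+n 2 5) ⟩
  7 + N              ≤⟨ bound ⟩
  7 * leavesIn B F   ∎
  where
  open ≤-Reasoning
  open Code (unaryCode u c)
  -- Sets are numbered by `Fin (2 ^ suc m)`, so that an injection into the numbered codes compares
  -- the two powers of 2.
  choice : Fin (2 ^ suc m) → Fin (suc m) → Bool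
  choice x = Inverse.to 2↔Bool ∘ finToFun x
  index : Fin (2 ^ suc m) → Fin (2 ^ (2 + N))
  index x = bitsToFin (encode (σ (choice x)))
  funToFin-cong : ∀ {n} {f g : Fin n → Fin 2} → f ≗ g → funToFin f ≡ funToFin g
  funToFin-cong {zero}  f≗g = refl
  funToFin-cong {suc n} f≗g = cong₂ combine (f≗g zero) (funToFin-cong (f≗g ∘ suc))
  ^-cancelʳ-≤ : ∀ {x y} → 2 ^ x ≤ 2 ^ y → x ≤ y
  ^-cancelʳ-≤ {x} {y} le = ≮⇒≥ λ y<x → <⇒≱ (^-monoʳ-< 2 (s≤s (s≤s z≤n)) y<x) le
  index-injective : ∀ {x y} → index x ≡ index y → x ≡ y
  index-injective {x} {y} eq′ =
    trans (sym (funToFin-finToFin {suc m} x))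
      (trans (funToFin-cong finToFun-eq) (funToFin-finToFin {suc m} y))
    where
    choice-eq : choice x ≗ choice y
    choice-eq q = trans (sym (dec (choice x) q)) (trans (eq _ _)
      (trans (sound _ _ (bitsToFin-injective (encode (σ (choice x))) _ eq′) (τ q))
        (trans (sym (eq _ _)) (dec (choice y) q))))
    finToFun-eq : finToFun {2} {suc m} x ≗ finToFun y
    finToFun-eq q = trans (sym (Inverse.strictlyInverseʳ 2↔Bool _))
      (trans (cong (Inverse.from 2↔Bool) (choice-eq q)) (Inverse.strictlyInverseʳ 2↔Bool _))

-- Leaves, wires and the partition into rows.

mutual
  leaves : Formula V → ℕ
  leaves (leaf v)    = 1
  leaves (gate g fs) = leavesList fs

  leavesList : List (Formula V) → ℕ
  leavesList []       = 0
  leavesList (f ∷ fs) = leaves f + leavesList fs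

mutual
  -- Each leaf other than the root is the lower end of its own wire.
  leaves≤1+wires : (F : Formula V) → leaves F ≤ 1 + wires F
  leaves≤1+wires (leaf v)    = ≤-refl
  leaves≤1+wires (gate g fs) = m≤n⇒m≤1+n (leavesList≤wires fs)

  leavesList≤wires : (fs : List (Formula V)) → leavesList fs ≤ length fs + wiresList fs
  leavesList≤wires []       = z≤n
  leavesList≤wires (f ∷ fs) = ≤-trans (+-mono-≤ (leaves≤1+wires f) (leavesList≤wires fs))
    (≤-reflexive (swap (wires f) (length fs) (wiresList fs)))
    where
    swap : ∀ x y z → 1 + x + (y + z) ≡ 1 + y + (x + z)
    swap = solve-∀

sumFin-+ : ∀ n (f g : Fin n → ℕ) → sumFin n (λ i → f i + g i) ≡ sumFin n f + sumFin n g
sumFin-+ zero    f g = refl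
sumFin-+ (suc n) f g rewrite sumFin-+ n (f ∘ suc) (g ∘ suc) =
  swap (f zero) (g zero) (sumFin n (f ∘ suc)) (sumFin n (g ∘ suc))
  where
  swap : ∀ x y z w → x + y + (z + w) ≡ x + z + (y + w)
  swap = solve-∀

sumFin-0 : ∀ n {f : Fin n → ℕ} → (∀ i → f i ≡ 0) → sumFin n f ≡ 0
sumFin-0 zero    f≡0 = refl
sumFin-0 (suc n) f≡0 = cong₂ _+_ (f≡0 zero) (sumFin-0 n (f≡0 ∘ suc))

sumFin-indicator : (j : Fin n) → sumFin n (λ i → bit (does (i ≟ j))) ≡ 1
sumFin-indicator {suc n} zero    = cong suc (sumFin-0 n λ _ → refl)
sumFin-indicator {suc n} (suc j) = sumFin-indicator j

*≤sumFin : ∀ n (f : Fin n → ℕ) → (∀ i → m ≤ k * f i) → n * m ≤ k * sumFin n f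
*≤sumFin zero            f m≤ = z≤n
*≤sumFin {k = k} (suc n) f m≤ = ≤-trans (+-mono-≤ (m≤ zero) (*≤sumFin {k = k} n (f ∘ suc) (m≤ ∘ suc)))
  (≤-reflexive (sym (*-distribˡ-+ k (f zero) _)))

row : Fin n → Fin n × Fin d → Bool
row i (j , _) = does (i ≟ j)

mutual
  -- The rows partition the variables, so each leaf is counted for exactly one `i`.
  sum-leavesIn-row : (F : Formula (Fin n × Fin d)) → sumFin n (λ i → leavesIn (row i) F) ≡ leaves F
  sum-leavesIn-row (leaf (j , _)) = sumFin-indicator j
  sum-leavesIn-row (gate g fs)    = sum-leavesInList-row fs

  sum-leavesInList-row : (fs : List (Formula (Fin n × Fin d))) →
                         sumFin n (λ i → leavesInList (row i) fs) ≡ leavesList fs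
  sum-leavesInList-row {n} []       = sumFin-0 n λ _ → refl
  sum-leavesInList-row {n} (f ∷ fs) = trans (sumFin-+ n (λ i → leavesIn (row i) f) _)
    (cong₂ _+_ (sum-leavesIn-row f) (sum-leavesInList-row fs))

-- Words of fixed weight.

-- The recursion on the first letter mirrors Pascal's rule, which gives the length `n C k`.
words : (n k : ℕ) → List (Subset n)
words zero    zero    = [] ∷ []
words zero    (suc k) = []
words (suc n) zero    = List.map (false ∷_) (words n zero)
words (suc n) (suc k) = List.map (true ∷_) (words n k) List.++ List.map (false ∷_) (words n (suc k))

words-size : ∀ n k → All (λ w → ∣ w ∣ ≡ k) (words n k)
words-size zero    zero    = refl ∷ []
words-size zero    (suc k) = []
words-size (suc n) zero    = All.map⁺ (words-size n zero)
words-size (suc n) (suc k) =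
  All.++⁺ (All.map⁺ (All.map (cong suc) (words-size n k))) (All.map⁺ (words-size n (suc k)))

words-unique : ∀ n k → Unique (words n k)
words-unique zero    zero    = [] ∷ []
words-unique zero    (suc k) = []
words-unique (suc n) zero    = Unique.map⁺ ∷-injectiveʳ (words-unique n zero)
words-unique (suc n) (suc k) = Unique.++⁺
  (Unique.map⁺ ∷-injectiveʳ (words-unique n k)) (Unique.map⁺ ∷-injectiveʳ (words-unique n (suc k)))
  λ (∈₁ , ∈₂) → case-disjoint (∈-map⁻ _ ∈₁) (∈-map⁻ _ ∈₂)
  where
  case-disjoint : ∀ {w : Subset (suc n)} {P Q : Subset n → Set} →
    (∃ λ v → P v × w ≡ true ∷ v) → (∃ λ v → Q v × w ≡ false ∷ v) → ⊥
  case-disjoint (_ , _ , refl) (_ , _ , ())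

length-words : ∀ n k → length (words n k) ≡ n C k
length-words zero    zero    = refl
length-words zero    (suc k) = refl
length-words (suc n) zero    = trans (length-map _ (words n zero)) (length-words n zero)
length-words (suc n) (suc k) = begin
  length (words (suc n) (suc k))                 ≡⟨ length-++ (List.map (true ∷_) (words n k)) ⟩
  length (List.map (true ∷_) (words n k)) + length (List.map (false ∷_) (words n (suc k)))
    ≡⟨ cong₂ _+_ (length-map _ (words n k)) (length-map _ (words n (suc k))) ⟩
  length (words n k) + length (words n (suc k))  ≡⟨ cong₂ _+_ (length-words n k) (length-words n (suc k)) ⟩
  n C k + n C suc k                              ≡⟨ nCk+nC[k+1]≡[n+1]C[k+1] n k ⟩
  suc n C suc k                                  ∎
  where open ≡-Reasoning

lookup-injective : {xs : List A} → Unique xs → ∀ i j → List.lookup xs i ≡ List.lookup xs j → i ≡ j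
lookup-injective (_ ∷ _)   zero    zero    _  = refl
lookup-injective {xs = _ ∷ xs} (x∉ ∷ _) zero (suc j) eq = contradiction eq (All.lookup x∉ (∈-lookup {xs = xs} j))
lookup-injective {xs = _ ∷ xs} (x∉ ∷ _) (suc i) zero eq = contradiction (sym eq) (All.lookup x∉ (∈-lookup {xs = xs} i))
lookup-injective (_ ∷ uxs) (suc i) (suc j) eq = cong suc (lookup-injective uxs i j eq)

-- Orthogonality, and the antichain property of a layer.

Meet : (u v : Fin d → Bool) → Set
Meet u v = ∃ λ k → u k ≡ true × v k ≡ true

meet⇒inner≢0 : (u v : Fin d → Bool) → Meet u v → isZero (inner u v) ≡ false
meet⇒inner≢0 u v (zero , uk , vk) rewrite uk | vk = refl
meet⇒inner≢0 u v (suc k , uk , vk) with u zero ∧ v zero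
... | true  = refl
... | false = meet⇒inner≢0 (u ∘ suc) (v ∘ suc) (k , uk , vk)

disjoint⇒inner≡0 : (u v : Fin d → Bool) → (∀ k → u k ∧ v k ≡ false) → inner u v ≡ 0
disjoint⇒inner≡0 {d} u v u∧v = sumFin-0 d λ k → cong bit (u∧v k)

anyFin-true : {p : Fin n → Bool} → ∀ i → p i ≡ true → anyFin n p ≡ true
anyFin-true zero pi rewrite pi = refl
anyFin-true {p = p} (suc i) pi rewrite anyFin-true {p = p ∘ suc} i pi = ∨-zeroʳ (p zero)

anyFin-false : ∀ n {p : Fin n → Bool} → (∀ i → p i ≡ false) → anyFin n p ≡ false
anyFin-false zero    p≡ = refl
anyFin-false (suc n) p≡ rewrite p≡ zero = anyFin-false n (p≡ ∘ suc)

OV-true : (x : Fin n × Fin d → Bool) → ∀ i j → (∀ k → x (i , k) ∧ x (j , k) ≡ false) →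
          OV n d x ≡ true
OV-true x i j disj = anyFin-true i (anyFin-true j (cong isZero (disjoint⇒inner≡0 (λ k → x (i , k)) (λ k → x (j , k)) disj)))

OV-false : (x : Fin n × Fin d → Bool) →
           (∀ i j → Meet (λ k → x (i , k)) (λ k → x (j , k))) → OV n d x ≡ false
OV-false {n} x meet = anyFin-false n λ i → anyFin-false n λ j → meet⇒inner≢0 _ _ (meet i j)

-- If no element of `u` is missing from `v`, then `u` is contained in `v`, hence equal to it or
-- strictly smaller.
compare-sets : (u v : Subset d) →
               (∃ λ k → lookup u k ≡ true × lookup v k ≡ false) ⊎ u ≡ v ⊎ ∣ u ∣ < ∣ v ∣
compare-sets []      []      = inj₂ (inj₁ refl)
compare-sets (x ∷ u) (y ∷ v) with compare-sets u v
compare-sets (x ∷ u)     (y ∷ v)     | inj₁ (k , uk , vk) = inj₁ (suc k , uk , vk)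
compare-sets (true  ∷ u) (false ∷ v) | inj₂ _             = inj₁ (zero , refl , refl)
compare-sets (true  ∷ u) (true  ∷ v) | inj₂ (inj₁ refl)   = inj₂ (inj₁ refl)
compare-sets (true  ∷ u) (true  ∷ v) | inj₂ (inj₂ lt)     = inj₂ (inj₂ (s≤s lt))
compare-sets (false ∷ u) (true  ∷ v) | inj₂ (inj₁ refl)   = inj₂ (inj₂ ≤-refl)
compare-sets (false ∷ u) (true  ∷ v) | inj₂ (inj₂ lt)     = inj₂ (inj₂ (m≤n⇒m≤1+n lt))
compare-sets (false ∷ u) (false ∷ v) | inj₂ (inj₁ refl)   = inj₂ (inj₁ refl)
compare-sets (false ∷ u) (false ∷ v) | inj₂ (inj₂ lt)     = inj₂ (inj₂ lt)

lookup-∁ : (v : Subset d) → ∀ k → lookup (∁ v) k ≡ not (lookup v k)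
lookup-∁ v k = lookup-map k not v

-- Sets of equal size form an antichain: `u` has an element outside `v`. This is what lets a query
-- with the complement of one word ignore all the others.
meet-∁ : {u v : Subset d} → ∣ u ∣ ≡ ∣ v ∣ → u ≢ v → Meet (lookup u) (lookup (∁ v))
meet-∁ {u = u} {v} size u≢v with compare-sets u v
... | inj₁ (k , uk , vk)  = k , uk , trans (lookup-∁ v k) (cong not vk)
... | inj₂ (inj₁ u≡v)     = contradiction u≡v u≢v
... | inj₂ (inj₂ u<v)     = contradiction size (<⇒≢ u<v)

nonempty : (v : Subset d) → 0 < ∣ v ∣ → ∃ λ k → lookup v k ≡ true
nonempty (true  ∷ v) _  = zero , refl
nonempty (false ∷ v) 0< with nonempty v 0<
... | k , vk = suc k , vk

-- The lower bound for a single row.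

-- The words are prefixed by 1 and their complements by 0.  This makes any two rows outside the
-- distinguished one meet in the first coordinate.
min≤7*leavesIn-row : ∀ n d k → k < d → (F : Formula (Fin (suc n) × Fin (suc d))) →
  Computes F (OV (suc n) (suc d)) → ∀ i → n ⊓ (d C k) ≤ 7 * leavesIn (row i) F
min≤7*leavesIn-row n d k k<d F comp i =
  shattered≤7*leaves (row i) F σ (λ _ → true) (λ q (_ , c) → test q c) null decode
  where
  μ = n ⊓ (d C k)

  μ≤words : μ ≤ length (words d k)
  μ≤words = ≤-trans (m⊓n≤n n (d C k)) (≤-reflexive (sym (length-words d k)))

  word : Fin μ → Subset d
  word q = List.lookup (words d k) (inject≤ q μ≤words)

  word-size : ∀ q → ∣ word q ∣ ≡ k
  word-size q = All.lookup (words-size d k) (∈-lookup {xs = words d k} _)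

  word-injective : ∀ {q r} → word q ≡ word r → q ≡ r
  word-injective eq = inject≤-injective μ≤words μ≤words _ _ (lookup-injective (words-unique d k) _ _ eq)

  test : Fin μ → Fin (suc d) → Bool
  test q = lookup (false ∷ ∁ (word q))

  -- `OV` also pairs a row with itself, so the queried row must not be zero. Here `k < d` leaves the
  -- complement `d ∸ k` ones.
  test-nonempty : ∀ q → ∃ λ c → test q c ≡ true
  test-nonempty q with nonempty (∁ (word q)) (subst (0 <_) (sym size) (m<n⇒0<n∸m k<d))
    where
    size : ∣ ∁ (word q) ∣ ≡ d ∸ k
    size = trans (∣∁p∣≡n∸∣p∣ (word q)) (cong (d ∸_) (word-size q))
  ... | c , eq = suc c , eq

  -- `punchIn i` skips the distinguished row, leaving `n` places for the words.
  slot : Fin μ → Fin (suc n)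
  slot q = punchIn i (inject≤ q (m⊓n≤m n (d C k)))

  slot-injective : ∀ {q r} → slot q ≡ slot r → q ≡ r
  slot-injective eq = inject≤-injective (m⊓n≤m n (d C k)) (m⊓n≤m n (d C k)) _ _ (punchIn-injective i _ _ eq)

  slot? : ∀ j → Dec (∃ λ q → slot q ≡ j)
  slot? j = any? λ q → slot q ≟ j

  -- The default is the all-ones row, used for words outside `S` and for spare rows: it meets every
  -- nonzero vector and so creates no orthogonal pair.
  fill : (Fin μ → Bool) → ∀ {j} → Dec (∃ λ q → slot q ≡ j) → Fin (suc d) → Bool
  fill S (yes (q , _)) c = if S q then lookup (true ∷ word q) c else true
  fill S (no _)        c = true

  σ : (Fin μ → Bool) → Fin (suc n) × Fin (suc d) → Bool
  σ S (j , c) = fill S (slot? j) c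

  fill-zero : ∀ S {j} (j? : Dec (∃ λ q → slot q ≡ j)) → fill S j? zero ≡ true
  fill-zero S (yes (q , _)) with S q
  ... | true  = refl
  ... | false = refl
  fill-zero S (no _) = refl

  fill-slot : ∀ S q → S q ≡ true → (q? : Dec (∃ λ r → slot r ≡ slot q)) →
              ∀ c → fill S q? c ≡ lookup (true ∷ word q) c
  fill-slot S q Sq (no ¬q)        c = contradiction (q , refl) ¬q
  fill-slot S q Sq (yes (r , eq)) c with slot-injective eq
  ... | refl rewrite Sq = refl

  fill-meets-test : ∀ S q → S q ≡ false → ∀ {j} (j? : Dec (∃ λ r → slot r ≡ j)) →
                    Meet (fill S j?) (test q)
  fill-meets-test S q Sq (no _) with test-nonempty q
  ... | c , eq = c , refl , eq
  fill-meets-test S q Sq (yes (r , _)) with S r in Sr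
  ... | false with test-nonempty q
  ...   | c , eq = c , refl , eq
  -- Since `S r` and `S q` differ, the two words are distinct and the antichain property applies.
  fill-meets-test S q Sq (yes (r , _)) | true
    with meet-∁ {u = word r} {word q} (trans (word-size r) (sym (word-size q)))
           (λ eq → not-¬ Sq (trans (sym (cong S (word-injective eq))) Sr))
  ... | c , eq₁ , eq₂ = suc c , eq₁ , eq₂

  module _ (S : Fin μ → Bool) (t : Fin (suc d) → Bool) where
    x : Fin (suc n) × Fin (suc d) → Bool
    x = override (row i) (σ S) (λ (_ , c) → t c)

    x-test : ∀ c → x (i , c) ≡ t c
    x-test c rewrite dec-true (i ≟ i) refl = refl

    x-other : ∀ {j} → i ≢ j → ∀ c → x (j , c) ≡ σ S (j , c)
    x-other {j} i≢j c rewrite dec-false (i ≟ j) i≢j = refl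

    x-row : ∀ j → (∀ c → x (j , c) ≡ t c) ⊎ (∀ c → x (j , c) ≡ σ S (j , c))
    x-row j with i ≟ j
    ... | yes _ = inj₁ λ _ → refl
    ... | no _  = inj₂ λ _ → refl

    x-meets : (∃ λ c → t c ≡ true) → (∀ j → Meet (λ c → σ S (j , c)) t) →
              ∀ j j′ → Meet (λ c → x (j , c)) (λ c → x (j′ , c))
    -- The queried row meets itself at `c`; two other rows meet in coordinate `zero`; the mixed
    -- pairs are covered by `meets`.
    x-meets (c , tc) meets j j′ with x-row j | x-row j′
    ... | inj₁ eq | inj₁ eq′ = c , trans (eq c) tc , trans (eq′ c) tc
    ... | inj₂ eq | inj₂ eq′ = zero , trans (eq zero) (fill-zero S (slot? j)) , trans (eq′ zero) (fill-zero S (slot? j′))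
    ... | inj₁ eq | inj₂ eq′ with meets j′
    ...   | c′ , σc′ , tc′   = c′ , trans (eq c′) tc′ , trans (eq′ c′) σc′
    x-meets (c , tc) meets j j′ | inj₂ eq | inj₁ eq′ with meets j
    ...   | c′ , σc′ , tc′   = c′ , trans (eq c′) σc′ , trans (eq′ c′) tc′

  null : ∀ S → eval (override (row i) (σ S) (λ _ → true)) F ≡ false
  null S = trans (comp _) (OV-false _
    (x-meets S (λ _ → true) (zero , refl) λ j → zero , fill-zero S (slot? j) , refl))

  decode : ∀ S q → eval (override (row i) (σ S) (λ (_ , c) → test q c)) F ≡ S q
  decode S q with S q in Sq
  ... | false = trans (comp _) (OV-false _
          (x-meets S (test q) (test-nonempty q) λ j → fill-meets-test S q Sq (slot? j)))
  -- The orthogonal pair is the row holding `word q` and the queried row holding its complement.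
  ... | true  = trans (comp _) (OV-true (x S (test q)) (slot q) i disjoint)
    where
    i≢slot : i ≢ slot q
    i≢slot eq = punchInᵢ≢i i _ (sym eq)
    word∧∁ : ∀ c → lookup (true ∷ word q) c ∧ test q c ≡ false
    word∧∁ zero    = refl
    word∧∁ (suc c) rewrite lookup-∁ (word q) c with lookup (word q) c
    ... | true  = refl
    ... | false = refl
    disjoint : ∀ c → x S (test q) (slot q , c) ∧ x S (test q) (i , c) ≡ false
    disjoint c = trans (cong₂ _∧_ (trans (x-other S (test q) i≢slot c) (fill-slot S q Sq (slot? (slot q)) c))
                                  (x-test S (test q) c))
                       (word∧∁ c)

-- Size of the middle binomial coefficient.

nCk*k!*[n∸k]!≡n! : k ≤ n → (n C k) * (k ! * (n ∸ k) !) ≡ n !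
nCk*k!*[n∸k]!≡n! {k} {n} k≤n = trans (cong (_* (k ! * (n ∸ k) !)) (nCk≡n!/k![n-k]! k≤n))
  (m/n*n≡m {{_}} (k![n∸k]!∣n! k≤n))

central : ℕ → ℕ
central k = (k + k) C k

central*k!*k! : ∀ k → central k * (k ! * k !) ≡ (k + k) !
central*k!*k! k = subst (λ x → central k * (k ! * x !) ≡ (k + k) !) (m+n∸m≡n k k)
  (nCk*k!*[n∸k]!≡n! (m≤m+n k k))

-- The ratio of consecutive central coefficients, obtained from the factorial formula by cancelling
-- `suc k * (k ! * k !)`.
central-suc : ∀ k → suc k * central (suc k) ≡ 2 * (1 + 2 * k) * central k
central-suc k = *-cancelʳ-≡ _ _ (suc k * (k ! * k !)) {{m*n≢0 (suc k) (k ! * k !) {{_}} {{m*n≢0 (k !) (k !) {{k !≢0}} {{k !≢0}}}}}} (begin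
  suc k * c′ * (suc k * (k ! * k !))               ≡⟨ lhs k c′ (k !) ⟩
  c′ * (suc k ! * suc k !)                         ≡⟨ central*k!*k! (suc k) ⟩
  (suc k + suc k) !                                ≡⟨ cong (λ x → suc x !) (+-suc k k) ⟩
  (2 + (k + k)) * ((1 + (k + k)) * (k + k) !)      ≡⟨ cong (λ x → (2 + (k + k)) * ((1 + (k + k)) * x)) (sym (central*k!*k! k)) ⟩
  (2 + (k + k)) * ((1 + (k + k)) * (central k * (k ! * k !))) ≡⟨ rhs k (central k) (k !) ⟩
  2 * (1 + 2 * k) * central k * (suc k * (k ! * k !))       ∎)
  where
  open ≡-Reasoning
  c′ = central (suc k)
  lhs : ∀ k c f → (1 + k) * c * ((1 + k) * (f * f)) ≡ c * ((1 + k) * f * ((1 + k) * f))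
  lhs = solve-∀
  rhs : ∀ k c f → (2 + (k + k)) * ((1 + (k + k)) * (c * (f * f))) ≡ 2 * (1 + 2 * k) * c * ((1 + k) * (f * f))
  rhs = solve-∀

-- The estimate that `central k` is at least `4 ^ k` over the root of `4 * k + 1`, squared to stay
-- in the naturals.
16^k≤central²*[4k+1] : ∀ k → 16 ^ k ≤ central k * central k * (4 * k + 1)
16^k≤central²*[4k+1] zero    = ≤-refl
16^k≤central²*[4k+1] (suc k) = *-cancelˡ-≤ (suc k * suc k) (begin
  suc k * suc k * (16 * 16 ^ k)                    ≤⟨ *-monoʳ-≤ (suc k * suc k) (*-monoʳ-≤ 16 (16^k≤central²*[4k+1] k)) ⟩
  -- After scaling by the square of `suc k`, the two sides of the induction step differ by exactly
  -- `4 * (c * c)`.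
  suc k * suc k * (16 * (c * c * (4 * k + 1)))     ≤⟨ m≤m+n _ (4 * (c * c)) ⟩
  suc k * suc k * (16 * (c * c * (4 * k + 1))) + 4 * (c * c)
                                                   ≡⟨ cubic k c ⟩
  2 * (1 + 2 * k) * c * (2 * (1 + 2 * k) * c) * (4 * suc k + 1)
    ≡⟨ cong (λ x → x * x * (4 * suc k + 1)) (sym (central-suc k)) ⟩
  suc k * c′ * (suc k * c′) * (4 * suc k + 1)      ≡⟨ regroup (suc k) c′ (4 * suc k + 1) ⟩
  suc k * suc k * (c′ * c′ * (4 * suc k + 1))      ∎)
  where
  open ≤-Reasoning
  c  = central k
  c′ = central (suc k)
  cubic : ∀ k c → (1 + k) * (1 + k) * (16 * (c * c * (4 * k + 1))) + 4 * (c * c)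
                  ≡ 2 * (1 + 2 * k) * c * (2 * (1 + 2 * k) * c) * (4 * (1 + k) + 1)
  cubic = solve-∀
  regroup : ∀ s c x → s * c * (s * c) * x ≡ s * s * (c * c * x)
  regroup = solve-∀

-- By Pascal's rule the central coefficient is a summand of the next one.
central≤odd : ∀ k → central k ≤ suc (k + k) C k
central≤odd zero    = ≤-refl
central≤odd (suc k) = ≤-trans (m≤n+m _ _) (≤-reflexive (nCk+nC[k+1]≡[n+1]C[k+1] (suc k + suc k) k))

halves : ∀ d → d ≡ ⌊ d /2⌋ + ⌊ d /2⌋ ⊎ d ≡ suc (⌊ d /2⌋ + ⌊ d /2⌋)
halves zero          = inj₁ refl
halves (suc zero)    = inj₂ refl
halves (suc (suc d)) with halves d
... | inj₁ eq = inj₁ (cong suc (trans (cong suc eq) (sym (+-suc _ _))))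
... | inj₂ eq = inj₂ (cong suc (trans (cong suc eq) (cong suc (sym (+-suc _ _)))))

middle : ℕ → ℕ
middle d = d C ⌊ d /2⌋

central≤middle : ∀ d → central ⌊ d /2⌋ ≤ middle d
central≤middle d with halves d
... | inj₁ eq = ≤-reflexive (cong (_C ⌊ d /2⌋) (sym eq))
... | inj₂ eq = ≤-trans (central≤odd ⌊ d /2⌋) (≤-reflexive (cong (_C ⌊ d /2⌋) (sym eq)))

4^d≤32*middle²*d : ∀ d → 4 ^ suc d ≤ 32 * (middle d * middle d) * suc d
4^d≤32*middle²*d d = begin
  -- Rounding `d` up to `2 * h + 1` gives the factor 16; a further 2 comes from
  -- `4 * h + 1 ≤ 2 * suc d`. Together they make 32.
  4 ^ suc d                                  ≤⟨ *-monoʳ-≤ 4 (^-monoʳ-≤ 4 d≤) ⟩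
  4 ^ (2 + (h + h))                          ≡⟨ cong (λ x → 4 * (4 * x)) 4^[h+h] ⟩
  4 * (4 * 16 ^ h)                           ≡⟨ sym (*-assoc 4 4 (16 ^ h)) ⟩
  16 * 16 ^ h                                ≤⟨ *-monoʳ-≤ 16 (16^k≤central²*[4k+1] h) ⟩
  16 * (central h * central h * (4 * h + 1)) ≤⟨ *-monoʳ-≤ 16 (*-mono-≤ (*-mono-≤ (central≤middle d) (central≤middle d)) 4h+1≤) ⟩
  16 * (middle d * middle d * (2 * suc d))   ≡⟨ regroup (middle d) (suc d) ⟩
  32 * (middle d * middle d) * suc d         ∎
  where
  open ≤-Reasoning
  h = ⌊ d /2⌋
  regroup : ∀ x y → 16 * (x * x * (2 * y)) ≡ 32 * (x * x) * y
  regroup = solve-∀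
  d≤ : d ≤ suc (h + h)
  d≤ with halves d
  ... | inj₁ eq = m≤n⇒m≤1+n (≤-reflexive eq)
  ... | inj₂ eq = ≤-reflexive eq
  2h≤d : h + h ≤ d
  2h≤d with halves d
  ... | inj₁ eq = ≤-reflexive (sym eq)
  ... | inj₂ eq = ≤-trans (n≤1+n _) (≤-reflexive (sym eq))
  4h+1≤ : 4 * h + 1 ≤ 2 * suc d
  4h+1≤ = begin
    4 * h + 1         ≡⟨ four h ⟩
    2 * (h + h) + 1   ≤⟨ +-mono-≤ (*-monoʳ-≤ 2 2h≤d) (s≤s (z≤n {1})) ⟩
    2 * d + 2         ≡⟨ double d ⟩
    2 * suc d         ∎
    where
    four : ∀ h → 4 * h + 1 ≡ 2 * (h + h) + 1
    four = solve-∀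
    double : ∀ d → 2 * d + 2 ≡ 2 * (1 + d)
    double = solve-∀
  4^[h+h] : 4 ^ (h + h) ≡ 16 ^ h
  4^[h+h] = trans (cong (4 ^_) (cong (h +_) (sym (+-identityʳ h)))) (sym (^-*-assoc 4 2 h))

-- Summation over rows and the final constants.

OV-ones : ∀ n d → OV n (suc d) (λ _ → true) ≡ false
OV-ones n d = OV-false {n} {suc d} (λ _ → true) λ _ _ → zero , refl , refl

OV-zeros : ∀ n d → OV (suc n) d (λ _ → false) ≡ true
OV-zeros n d = OV-true {suc n} {d} (λ _ → false) zero zero λ _ → refl

-- Only a bare leaf has more leaves than wires, and on the zero input it outputs 0 where `OV` is 1.
leaves≤wires : ∀ n d (F : Formula (Fin (suc n) × Fin d)) →
               Computes F (OV (suc n) d) → leaves F ≤ wires F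
leaves≤wires n d (leaf v) comp with trans (comp (λ _ → false)) (OV-zeros n d)
... | ()
leaves≤wires n d (gate g fs) comp = leavesList≤wires fs

-- A gate without children is constant, whereas `OV` takes both values.
1≤wires : ∀ n d (F : Formula (Fin (suc n) × Fin (suc d))) →
          Computes F (OV (suc n) (suc d)) → 1 ≤ wires F
1≤wires n d (leaf v)          comp = leaves≤wires n (suc d) (leaf v) comp
1≤wires n d (gate g [])       comp
  with trans (sym (trans (comp (λ _ → true)) (OV-ones (suc n) d))) (trans (comp (λ _ → false)) (OV-zeros n (suc d)))
... | ()
1≤wires n d (gate g (f ∷ fs)) comp = s≤s z≤n

rows*min≤7*wires : ∀ n d (F : Formula (Fin (suc n) × Fin (2 + d))) →
  Computes F (OV (suc n) (2 + d)) → suc n * (n ⊓ middle (suc d)) ≤ 7 * wires F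
rows*min≤7*wires n d F comp = begin
  suc n * (n ⊓ middle (suc d))
    ≤⟨ *≤sumFin {k = 7} (suc n) (λ i → leavesIn (row i) F) (min≤7*leavesIn-row n (suc d) _ (⌊n/2⌋<n d) F comp) ⟩
  7 * sumFin (suc n) (λ i → leavesIn (row i) F)
    ≡⟨ cong (7 *_) (sum-leavesIn-row F) ⟩
  7 * leaves F
    ≤⟨ *-monoʳ-≤ 7 (leaves≤wires n (2 + d) F comp) ⟩
  7 * wires F                                      ∎
  where open ≤-Reasoning

-- With `suc n` rows only `n` words fit. Replacing `n` by `suc n` costs a factor 2, except for a
-- single row, where the product vanishes and `1 ≤ w` takes over.
n²≤14w : ∀ n w → 1 ≤ w → suc n * n ≤ 7 * w → suc n * suc n ≤ 14 * w
n²≤14w zero    w 1≤w _  = ≤-trans 1≤w (m≤m+n w _)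
n²≤14w (suc n) w 1≤w le = begin
  (2 + n) * (2 + n)         ≤⟨ *-monoʳ-≤ (2 + n) (≤-trans (m≤m+n (2 + n) n) (≤-reflexive (double n))) ⟩
  (2 + n) * (2 * (1 + n))   ≡⟨ regroup (2 + n) (1 + n) ⟩
  2 * ((2 + n) * (1 + n))   ≤⟨ *-monoʳ-≤ 2 le ⟩
  2 * (7 * w)               ≡⟨ sym (*-assoc 2 7 w) ⟩
  14 * w                    ∎
  where
  open ≤-Reasoning
  double : ∀ n → 2 + n + n ≡ 2 * (1 + n)
  double = solve-∀
  regroup : ∀ x y → x * (2 * y) ≡ 2 * (x * y)
  regroup = solve-∀

[m*n]^2≡m^2*n^2 : ∀ m n → (m * n) ^ 2 ≡ m ^ 2 * n ^ 2
[m*n]^2≡m^2*n^2 = expand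
  where
  expand : ∀ m n → m * n * (m * n * 1) ≡ m * (m * 1) * (n * (n * 1))
  expand = solve-∀

-- The inequality is cleared of the logarithm and the root of `d` by multiplying and squaring, so
-- `c` plays the part of the inverse square of the constant `κ`. Rounding the logarithm down only
-- strengthens the bound.
theorem1p3 : Σ ℕ (λ c → (n d : ℕ) → 1 ≤ n → 2 ≤ d →
    (F : Formula (Fin n × Fin d)) → Computes F (OV n d) →
    ((n * n) ^ 2 * d) ⊓ ((n * 2 ^ d) ^ 2) ≤ c * (wires F * ⌊log₂ d ⌋) ^ 2 * d)
-- `1568 = 32 * 7 ^ 2` comes from the case where the binomial coefficient is the minimum; the other
-- case needs `14 ^ 2 = 196`.
theorem1p3 = 1568 , bound
  where
  open ≤-Reasoning
  square-mono : ∀ {x y} → x ≤ y → x ^ 2 ≤ y ^ 2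
  square-mono = ^-monoˡ-≤ 2

  bound : (n d : ℕ) → 1 ≤ n → 2 ≤ d → (F : Formula (Fin n × Fin d)) → Computes F (OV n d) →
    ((n * n) ^ 2 * d) ⊓ ((n * 2 ^ d) ^ 2) ≤ 1568 * (wires F * ⌊log₂ d ⌋) ^ 2 * d
  bound (suc n) (suc (suc d)) (s≤s _) (s≤s (s≤s _)) F comp = begin
    (n⁺ * n⁺) ^ 2 * d⁺ ⊓ (n⁺ * 2 ^ d⁺) ^ 2    ≤⟨ min-bound (⊓-sel n M) ⟩
    1568 * w ^ 2 * d⁺                     ≤⟨ *-monoˡ-≤ d⁺ (*-monoʳ-≤ 1568 (square-mono w≤wℓ)) ⟩
    1568 * (w * ⌊log₂ d⁺ ⌋) ^ 2 * d⁺       ∎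
    where
    n⁺ = suc n
    d⁺ = suc (suc d)
    w = wires F
    M = middle (suc d)

    w≤wℓ : w ≤ w * ⌊log₂ d⁺ ⌋
    -- From `2 ≤ d` the rounded logarithm is at least 1.
    w≤wℓ = ≤-trans (≤-reflexive (sym (*-identityʳ w))) (*-monoʳ-≤ w (⌊log₂⌋-mono-≤ {2} {d⁺} (s≤s (s≤s z≤n))))

    rows-bound : n⁺ * (n ⊓ M) ≤ 7 * w
    rows-bound = rows*min≤7*wires n d F comp

    min-bound : n ⊓ M ≡ n ⊎ n ⊓ M ≡ M → (n⁺ * n⁺) ^ 2 * d⁺ ⊓ (n⁺ * 2 ^ d⁺) ^ 2 ≤ 1568 * w ^ 2 * d⁺
    min-bound (inj₁ eq) = begin
      (n⁺ * n⁺) ^ 2 * d⁺ ⊓ (n⁺ * 2 ^ d⁺) ^ 2  ≤⟨ m⊓n≤m _ _ ⟩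
      (n⁺ * n⁺) ^ 2 * d⁺                    ≤⟨ *-monoˡ-≤ d⁺ (square-mono (n²≤14w n w (1≤wires n (suc d) F comp) (subst (λ x → n⁺ * x ≤ 7 * w) eq rows-bound))) ⟩
      (14 * w) ^ 2 * d⁺                   ≡⟨ cong (_* d⁺) ([m*n]^2≡m^2*n^2 14 w) ⟩
      196 * w ^ 2 * d⁺                    ≤⟨ *-monoˡ-≤ d⁺ (*-monoˡ-≤ (w ^ 2) (m≤m+n 196 1372)) ⟩
      1568 * w ^ 2 * d⁺                   ∎
    min-bound (inj₂ eq) = begin
      (n⁺ * n⁺) ^ 2 * d⁺ ⊓ (n⁺ * 2 ^ d⁺) ^ 2  ≤⟨ m⊓n≤n _ _ ⟩
      (n⁺ * 2 ^ d⁺) ^ 2                    ≡⟨ [m*n]^2≡m^2*n^2 n⁺ (2 ^ d⁺) ⟩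
      n⁺ ^ 2 * (2 ^ d⁺) ^ 2                ≡⟨ cong (n⁺ ^ 2 *_) 2^D^2 ⟩
      n⁺ ^ 2 * 4 ^ d⁺                      ≤⟨ *-monoʳ-≤ (n⁺ ^ 2) (4^d≤32*middle²*d (suc d)) ⟩
      n⁺ ^ 2 * (32 * (M * M) * d⁺)         ≡⟨ regroup n⁺ M d⁺ ⟩
      32 * (n⁺ * M) ^ 2 * d⁺               ≤⟨ *-monoˡ-≤ d⁺ (*-monoʳ-≤ 32 (square-mono (subst (λ x → n⁺ * x ≤ 7 * w) eq rows-bound))) ⟩
      32 * (7 * w) ^ 2 * d⁺               ≡⟨ cong (_* d⁺) (trans (cong (32 *_) ([m*n]^2≡m^2*n^2 7 w)) (sym (*-assoc 32 49 (w ^ 2)))) ⟩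
      1568 * w ^ 2 * d⁺                   ∎
      where
      2^D^2 : (2 ^ d⁺) ^ 2 ≡ 4 ^ d⁺
      2^D^2 = trans (^-*-assoc 2 d⁺ 2) (trans (cong (2 ^_) (*-comm d⁺ 2)) (sym (^-*-assoc 2 2 d⁺)))
      regroup : ∀ x y z → x * (x * 1) * (32 * (y * y) * z) ≡ 32 * (x * y * (x * y * 1)) * z
      regroup = solve-∀
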